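{- The class $\mathscr B$ of all complete bipartite graphs is weakly $\chi_p$-bounded but not strongly $\chi_p$-bounded.
   Context: $\omega(G)$ is the clique number of a graph $G$; for a class $\mathscr D$ of graphs, $\omega(\mathscr D)=\sup_{G\in\mathscr D}\omega(G)$. For a non-negative integer $r$, ${\rm TM}_r(G)$ is the class of all graphs $H$ such that some graph obtained from $H$ by subdividing each edge by at most $r$ vertices is a subgraph of $G$. The tree-depth ${\rm td}(G)$ is the minimum height (number of vertices on a longest root-to-leaf path) of a rooted forest $Y$ such that $G$ is a subgraph of the closure of $Y$ (the graph in which each vertex is adjacent to all its ancestors in $Y$). For a positive integer $p$, $\chi_p(G)$ is the minimum number of colors in a vertex coloring of $G$ such that every set $I$ of at most $p$ colors induces a subgraph of $G$ with tree-depth at most $|I|$. A class is hereditary if it is closed under induced subgraphs. A hereditary class $\mathscr C$ is strongly $\chi_p$-bounded if there is a fixed function $f_p$ with $\chi_p(G)\leq f_p(\omega(G))$ for every $G\in\mathscr C$; it is weakly $\chi_p$-bounded if there is a fixed function $g_p$ with $\chi_p(G)\leq g_p(\omega({\rm TM}_{p-1}(G)))$ for every $G\in\mathscr C$. When $p$ is not specified, as in the claim, "weakly (respectively strongly) $\chi_p$-bounded" means that the property holds for every positive integer $p$; so the negative part says that the property fails for at least one $p$. -}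

module Defs where

open import Data.Bool.Base using (Bool)
open import Data.Empty using (⊥)
open import Data.Fin.Base as Fin using (Fin; toℕ)
import Data.Fin.Properties as Finₚ
open import Data.Fin.Subset using (Subset; _∈_; ∣_∣)
open import Data.List.Base using (List; []; _∷_)
open import Data.Nat.Base using (ℕ; suc; pred; _≤_; _⊔_)
import Data.Nat.Properties as ℕₚ
open import Data.Product.Base using (_×_; _,_; ∃-syntax; Σ-syntax)
open import Data.Refinement.Base using (Refinement; value)
open import Function.Base using (_on_)
open import Function.Bundles using (_⇔_)
open import Function.Definitions using (Injective)
open import Level using (Level; 0ℓ)
open import Relation.Binary.Construct.Closure.Symmetric
  using (SymClosure; fwd; bwd; symmetric)
open import Relation.Binary.Core using (Rel)
open import Relation.Binary.Definitions using (Symmetric; Irreflexive)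
open import Relation.Binary.PropositionalEquality
  using (_≡_; _≢_; refl; sym; ≢-sym)

-- A numerical invariant is given by the predicate "k is its value", so
-- that no decision procedure is needed to define it.  For finite graphs
-- every value used below exists (classically) and is unique.

IsMinimum : (ℕ → Set) → ℕ → Set
IsMinimum P k = P k × (∀ j → P j → k ≤ j)

IsMaximum : (ℕ → Set) → ℕ → Set
IsMaximum P k = P k × (∀ j → P j → j ≤ k)

IsSupremum : {ℓ : Level} → (ℕ → Set ℓ) → ℕ → Set ℓ
IsSupremum P k = (∀ j → P j → j ≤ k) × (∀ u → (∀ j → P j → j ≤ u) → k ≤ u)

-- The finite graphs are the graphs on some Fin n.  Other vertex types
-- only serve for auxiliary graphs.

record Graph (V : Set) : Set₁ where
  field
    _~_      : Rel V 0ℓ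
    ~-sym    : Symmetric _~_
    ~-irrefl : Irreflexive _≡_ _~_

open Graph public using () renaming (_~_ to Adj)

private
  variable
    V W : Set
    n : ℕ

infix 4 _⊑_ _⊑ᵢ_

-- Being a subgraph, resp. an induced subgraph, up to isomorphism.

_⊑_ : Graph V → Graph W → Set
_⊑_ {V} {W} H G = Σ[ f ∈ (V → W) ]
  Injective _≡_ _≡_ f × (∀ x y → Adj H x y → Adj G (f x) (f y))

_⊑ᵢ_ : Graph V → Graph W → Set
_⊑ᵢ_ {V} {W} H G = Σ[ f ∈ (V → W) ]
  Injective _≡_ _≡_ f × (∀ x y → Adj H x y ⇔ Adj G (f x) (f y))

induced : Graph V → (P : V → Set) → Graph (Refinement V P)
induced G P = record
  { _~_      = Adj G on value
  ; ~-sym    = Graph.~-sym G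
  ; ~-irrefl = λ { refl → Graph.~-irrefl G refl }
  }

complete : (k : ℕ) → Graph (Fin k)
complete k = record
  { _~_      = _≢_
  ; ~-sym    = ≢-sym
  ; ~-irrefl = λ x≡y x≢y → x≢y x≡y
  }

-- A part may be empty: the class would not be hereditary otherwise.

IsCompleteBipartite : Graph V → Set
IsCompleteBipartite {V} G = Σ[ side ∈ (V → Bool) ]
  (∀ x y → Adj G x y ⇔ side x ≢ side y)

GraphClass : Set₁
GraphClass = ∀ {n} → Graph (Fin n) → Set

Hereditary : GraphClass → Set₁
Hereditary 𝒞 = ∀ {m n} (H : Graph (Fin m)) (G : Graph (Fin n)) →
  H ⊑ᵢ G → 𝒞 G → 𝒞 H

𝓑 : GraphClass
𝓑 G = IsCompleteBipartite G

IsCliqueNumber : Graph V → ℕ → Set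
IsCliqueNumber G = IsMaximum (λ k → complete k ⊑ G)

IsClassCliqueNumber : GraphClass → ℕ → Set₁
IsClassCliqueNumber 𝒟 = IsSupremum λ k →
  ∃[ n ] Σ[ H ∈ Graph (Fin n) ] 𝒟 H × IsCliqueNumber H k

-- Every edge {u , v} with u < v is replaced by the path
--   u , inner u v 0 , … , inner u v (s u v ∸ 1) , v.
-- The values of s at other pairs are not used.  The proofs in inner are
-- irrelevant, so that each edge is subdivided only once.

module _ (H : Graph (Fin n)) (s : Fin n → Fin n → ℕ) where

  data SubdivisionVertex : Set where
    branch : Fin n → SubdivisionVertex
    inner  : ∀ u v → .(u Fin.< v) → .(Adj H u v) → Fin (s u v) →
             SubdivisionVertex

  data PathStep : Rel SubdivisionVertex 0ℓ where
    whole : ∀ {u v} → u Fin.< v → Adj H u v → s u v ≡ 0 →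
            PathStep (branch u) (branch v)
    first : ∀ {u v} .{u<v : u Fin.< v} .{u~v : Adj H u v} {i} → toℕ i ≡ 0 →
            PathStep (branch u) (inner u v u<v u~v i)
    next  : ∀ {u v} .{u<v : u Fin.< v} .{u~v : Adj H u v} {i j} →
            toℕ j ≡ suc (toℕ i) →
            PathStep (inner u v u<v u~v i) (inner u v u<v u~v j)
    last  : ∀ {u v} .{u<v : u Fin.< v} .{u~v : Adj H u v} {i} →
            suc (toℕ i) ≡ s u v →
            PathStep (inner u v u<v u~v i) (branch v)

  private
    PathStep-irrefl : ∀ {x} → PathStep x x → ⊥
    PathStep-irrefl (whole u<u _ _) = Finₚ.<-irrefl refl u<u
    PathStep-irrefl (next i≡1+i)    = ℕₚ.1+n≢n (sym i≡1+i)

  subdivision : Graph SubdivisionVertex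
  subdivision = record
    { _~_      = SymClosure PathStep
    ; ~-sym    = symmetric PathStep
    ; ~-irrefl = λ { refl (fwd x→x) → PathStep-irrefl x→x
                   ; refl (bwd x→x) → PathStep-irrefl x→x }
    }

TM : ℕ → Graph V → GraphClass
TM r G {n} H = Σ[ s ∈ (Fin n → Fin n → ℕ) ]
  (∀ u v → s u v ≤ r) × subdivision H s ⊑ G

data Tree : Set where
  node : List Tree → Tree

Forest : Set
Forest = List Tree

height : Forest → ℕ
height []             = 0
height (node cs ∷ ts) = suc (height cs) ⊔ height ts

data ForestVertex : Forest → Set where
  root  : ∀ {cs ts} → ForestVertex (node cs ∷ ts)
  below : ∀ {cs ts} → ForestVertex cs → ForestVertex (node cs ∷ ts)
  later : ∀ {t ts} → ForestVertex ts → ForestVertex (t ∷ ts)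

-- x ≺ y : x is a proper ancestor of y.

data _≺_ : ∀ {F} → Rel (ForestVertex F) 0ℓ where
  root  : ∀ {cs ts} {y : ForestVertex cs} → root {cs} {ts} ≺ below y
  below : ∀ {cs ts} {x y : ForestVertex cs} → x ≺ y →
          below {cs} {ts} x ≺ below y
  later : ∀ {t ts} {x y : ForestVertex ts} → x ≺ y →
          later {t} {ts} x ≺ later y

private
  ≺-irrefl : ∀ {F} (x : ForestVertex F) → x ≺ x → ⊥
  ≺-irrefl (below x) (below x≺x) = ≺-irrefl x x≺x
  ≺-irrefl (later x) (later x≺x) = ≺-irrefl x x≺x

closure : (F : Forest) → Graph (ForestVertex F)
closure F = record
  { _~_      = SymClosure _≺_
  ; ~-sym    = symmetric _≺_
  ; ~-irrefl = λ { refl (fwd x≺x) → ≺-irrefl _ x≺x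
                 ; refl (bwd x≺x) → ≺-irrefl _ x≺x }
  }

IsTreeDepth : Graph V → ℕ → Set
IsTreeDepth G = IsMinimum (λ h → ∃[ F ] height F ≡ h × G ⊑ closure F)

IsPColouring : ℕ → Graph V → {k : ℕ} → (V → Fin k) → Set
IsPColouring p G {k} c = (I : Subset k) → ∣ I ∣ ≤ p →
  ∀ d → IsTreeDepth (induced G (λ x → c x ∈ I)) d → d ≤ ∣ I ∣

IsChi : ℕ → Graph V → ℕ → Set
IsChi {V} p G = IsMinimum λ k → Σ[ c ∈ (V → Fin k) ] IsPColouring p G c

StronglyChiBounded : ℕ → GraphClass → Set₁
StronglyChiBounded p 𝒞 = Σ[ f ∈ (ℕ → ℕ) ]
  (∀ {n} (G : Graph (Fin n)) → 𝒞 G →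
   ∀ w k → IsCliqueNumber G w → IsChi p G k → k ≤ f w)

WeaklyChiBounded : ℕ → GraphClass → Set₁
WeaklyChiBounded p 𝒞 = Σ[ g ∈ (ℕ → ℕ) ]
  (∀ {n} (G : Graph (Fin n)) → 𝒞 G →
   ∀ w k → IsClassCliqueNumber (TM (pred p) G) w → IsChi p G k → k ≤ g w)

{-# OPTIONS --safe #-}

module Submission where

-- Colour the vertices of one part of size m with distinct colours and the
-- other part with one more colour.  Any colours I then induce a graph
-- contained in the closure of a path with leaves attached at its lower end,
-- of height at most |I|, so χ_p ≤ m + 1 for every p.  If both parts have at
-- least k² vertices, the 1-subdivision of K_k is a subgraph (branch vertices
-- in one part, subdividing vertices in the other), so for p ≥ 2 the smaller
-- part has fewer than (ω + 1)² vertices.  For p = 1 a proper 2-colouring is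
-- enough.
--
-- In the other direction, ω(K_{N,N}) = 2, but a colouring with fewer than
-- N colours repeats a colour in each part, hence contains a C₄ on at most two
-- colours; as C₄ has tree-depth 3, χ_2(K_{N,N}) ≥ N.

open import Defs
open import Data.Bool.Base using (Bool; true; false)
import Data.Bool.Properties as Boolₚ
open import Data.Empty using (⊥; ⊥-elim; ⊥-elim-irr)
open import Data.Fin.Base
  using (Fin; zero; suc; fromℕ; inject₁; inject≤; combine; splitAt; _↑ˡ_; _↑ʳ_)
import Data.Fin.Properties as Finₚ
open import Data.Fin.Subset
  using (Subset; inside; outside; _∈_; _⊂_; _∪_; ⊤; ⁅_⁆; ∣_∣)
open import Data.Fin.Subset.Properties
  using (drop-there; _∈?_; nonempty?; ∈⊤; x∈⁅x⁆; x∈⁅y⁆⇒x≡y; ∣⁅x⁆∣≡1; p⊆q⇒∣p∣≤∣q∣;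
         p⊂q⇒∣p∣<∣q∣; x∈p∪q⁺)
open import Data.Irrelevant using ([_])
open import Data.List.Base using (List; []; _∷_; replicate; length; lookup; filter; allFin)
open import Data.List.Membership.Propositional.Properties
  using (∈-lookup; ∈-allFin; ∈-filter⁺; ∈-filter⁻)
import Data.List.Relation.Unary.All as All
open import Data.List.Relation.Unary.AllPairs using ([]; _∷_)
open import Data.List.Relation.Unary.Any using (index)
open import Data.List.Relation.Unary.Any.Properties using (lookup-index)
open import Data.List.Relation.Unary.Unique.Propositional using (Unique)
open import Data.List.Relation.Unary.Unique.Propositional.Properties using (allFin⁺; filter⁺)
open import Data.Nat.Base using (ℕ; zero; suc; _+_; _*_; _≤_; _<_; z≤n; s≤s)
open import Data.Nat.Induction using (<-rec)
open import Data.Nat.Properties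
  using (≤-refl; ≤-reflexive; ≤-trans; ≤-pred; ≤-<-trans; 1+n≰n; _≤?_; ≰⇒>; ≮⇒≥; n≤1+n;
         +-suc; +-monoʳ-≤; m≤m⊔n; m≤n⊔m; ⊔-lub)
open import Data.Product.Base using (_×_; _,_; proj₁; proj₂; ∃-syntax; Σ-syntax)
open import Data.Refinement.Base using (Refinement; value; proof; _,_)
open import Data.Sum.Base using (_⊎_; inj₁; inj₂; [_,_]′)
open import Data.Vec.Base using ([]; _∷_)
open import Function.Base using (_∘_; _∋_; id; const)
open import Function.Bundles using (_⇔_; mk⇔; Equivalence; Injection; Inverse)
open import Function.Construct.Composition using (_⇔-∘_)
open import Function.Definitions using (Injective)
open import Function.Properties.Inverse using (↔⇒↣; ↔-sym)
open import Relation.Binary.Construct.Closure.Symmetric using (SymClosure; fwd; bwd)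
import Relation.Binary.Construct.Closure.Symmetric as Sym
open import Relation.Binary.PropositionalEquality
  using (_≡_; _≢_; refl; sym; trans; cong; subst)
open import Relation.Nullary.Decidable using (yes; no; recompute; decidable-stable)
open import Relation.Nullary.Negation.Core using (¬_; contradiction)

private
  variable
    V W : Set
    m n k : ℕ

-- Minima, subset sizes and lists

-- For an undecidable `P` a least element exists only classically. The double negation suffices
-- where the goal is `⊥` or a decidable inequality.
¬¬-minimum : (P : ℕ → Set) → P k → ¬ ¬ (∃[ j ] IsMinimum P j)
¬¬-minimum {k} P Pk none = <-rec (λ j → ¬ P j)
  (λ j below-j Pj → none (j , Pj , λ i Pi → ≮⇒≥ λ i<j → below-j i<j Pi)) k Pk

∣p∪q∣≤∣p∣+∣q∣ : (p q : Subset n) → ∣ p ∪ q ∣ ≤ ∣ p ∣ + ∣ q ∣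
∣p∪q∣≤∣p∣+∣q∣ []            []            = z≤n
∣p∪q∣≤∣p∣+∣q∣ (outside ∷ p) (outside ∷ q) = ∣p∪q∣≤∣p∣+∣q∣ p q
∣p∪q∣≤∣p∣+∣q∣ (outside ∷ p) (inside ∷ q)
  rewrite +-suc ∣ p ∣ ∣ q ∣ = s≤s (∣p∪q∣≤∣p∣+∣q∣ p q)
∣p∪q∣≤∣p∣+∣q∣ (inside ∷ p)  (outside ∷ q) = s≤s (∣p∪q∣≤∣p∣+∣q∣ p q)
∣p∪q∣≤∣p∣+∣q∣ (inside ∷ p)  (inside ∷ q)  =
  s≤s (≤-trans (∣p∪q∣≤∣p∣+∣q∣ p q) (+-monoʳ-≤ ∣ p ∣ (n≤1+n ∣ q ∣)))

x∈p⇒0<∣p∣ : ∀ {p : Subset n} {x} → x ∈ p → 0 < ∣ p ∣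
x∈p⇒0<∣p∣ {p = p} {x} x∈p =
  ≤-trans (≤-reflexive (sym (∣⁅x⁆∣≡1 x)))
          (p⊆q⇒∣p∣≤∣q∣ {p = ⁅ x ⁆} {p} λ y∈ → subst (_∈ p) (sym (x∈⁅y⁆⇒x≡y x y∈)) x∈p)

∣p∣≤1⇒x≡y : ∀ {p : Subset n} {x y} → ∣ p ∣ ≤ 1 → x ∈ p → y ∈ p → x ≡ y
∣p∣≤1⇒x≡y {p = p} {x} {y} ∣p∣≤1 x∈p y∈p = decidable-stable (x Finₚ.≟ y) λ x≢y →
  1+n≰n (≤-trans (subst (_< ∣ p ∣) (∣⁅x⁆∣≡1 x) (p⊂q⇒∣p∣<∣q∣ (⁅x⁆⊂p x≢y))) ∣p∣≤1)
  where
  ⁅x⁆⊂p : x ≢ y → ⁅ x ⁆ ⊂ p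
  ⁅x⁆⊂p x≢y = (λ z∈ → subst (_∈ p) (sym (x∈⁅y⁆⇒x≡y x z∈)) x∈p)
            , y , y∈p , λ y∈ → x≢y (sym (x∈⁅y⁆⇒x≡y x y∈))

lookup-injective : ∀ {A : Set} {xs : List A} → Unique xs → Injective _≡_ _≡_ (lookup xs)
lookup-injective (_ ∷ _)    {zero}  {zero}  _  = refl
lookup-injective (x∉xs ∷ _) {zero}  {suc j} eq = contradiction eq (All.lookup x∉xs (∈-lookup j))
lookup-injective (x∉xs ∷ _) {suc i} {zero}  eq =
  contradiction (sym eq) (All.lookup x∉xs (∈-lookup i))
lookup-injective (_ ∷ xs!)  {suc i} {suc j} eq = cong suc (lookup-injective xs! eq)

-- Tree-depth upper bounds

leaf : Fin n → ForestVertex (replicate n (node []))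
leaf zero    = root
leaf (suc x) = later (leaf x)

leaf-injective : Injective _≡_ _≡_ (leaf {n})
leaf-injective {x = zero}  {zero}  _  = refl
leaf-injective {x = zero}  {suc _} ()
leaf-injective {x = suc _} {zero}  ()
leaf-injective {x = suc x} {suc y} eq = cong suc (leaf-injective (later-injective eq))
  where
  later-injective : ∀ {t ts} {u v : ForestVertex ts} → later {t} u ≡ later v → u ≡ v
  later-injective refl = refl

height-leaves : ∀ n → height (replicate n (node [])) ≤ 1
height-leaves zero    = z≤n
height-leaves (suc n) = ⊔-lub ≤-refl (height-leaves n)

-- A path with one vertex for each element of I other than the last colour,
-- with n leaves at its lower end if the last colour belongs to I.
broom : ℕ → Subset (suc m) → Forest
broom n (inside  ∷ [])        = replicate n (node [])
broom n (outside ∷ [])        = []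
broom n (inside  ∷ I@(_ ∷ _)) = node (broom n I) ∷ []
broom n (outside ∷ I@(_ ∷ _)) = broom n I

height-broom : ∀ n (I : Subset (suc m)) → height (broom n I) ≤ ∣ I ∣
height-broom n (inside  ∷ [])        = height-leaves n
height-broom n (outside ∷ [])        = z≤n
height-broom n (inside  ∷ I@(_ ∷ _)) = ⊔-lub (s≤s (height-broom n I)) z≤n
height-broom n (outside ∷ I@(_ ∷ _)) = height-broom n I

-- The index `x` selects a leaf when `i` is the last colour. Every other colour of `I` owns a single
-- path vertex.
position : (I : Subset (suc m)) (i : Fin (suc m)) → i ∈ I → Fin n →
           ForestVertex (broom n I)
position (inside  ∷ [])        zero    _   x = leaf x
position (outside ∷ [])        zero    ()  x
position (inside  ∷ (_ ∷ _))   zero    _   x = root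
position (outside ∷ (_ ∷ _))   zero    ()  x
position (inside  ∷ I@(_ ∷ _)) (suc i) i∈I x = below (position I i (drop-there i∈I) x)
position (outside ∷ I@(_ ∷ _)) (suc i) i∈I x = position I i (drop-there i∈I) x

position-injective : (I : Subset (suc m)) (i j : Fin (suc m)) (i∈I : i ∈ I) (j∈I : j ∈ I)
  (x y : Fin n) → position I i i∈I x ≡ position I j j∈I y → i ≡ j × (i ≡ fromℕ m → x ≡ y)
position-injective (inside  ∷ [])        zero zero _ _ x y eq = refl , λ _ → leaf-injective eq
position-injective (outside ∷ [])        zero zero () _ x y eq
position-injective (inside  ∷ (_ ∷ _))   zero zero _ _ x y eq = refl , λ ()
position-injective (inside  ∷ (_ ∷ _))   zero (suc j) _ _ x y ()
position-injective (inside  ∷ (_ ∷ _))   (suc i) zero _ _ x y ()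
position-injective (outside ∷ (_ ∷ _))   zero _ () _ x y eq
position-injective (outside ∷ (_ ∷ _))   (suc i) zero _ () x y eq
position-injective (inside  ∷ I@(_ ∷ _)) (suc i) (suc j) i∈I j∈I x y eq =
  let i≡j , x≡y = position-injective I i j (drop-there i∈I) (drop-there j∈I) x y
                    (below-injective eq)
  in cong suc i≡j , λ i≡last → x≡y (Finₚ.suc-injective i≡last)
  where
  below-injective : ∀ {cs ts} {u v : ForestVertex cs} → below {cs} {ts} u ≡ below v → u ≡ v
  below-injective refl = refl
position-injective (outside ∷ I@(_ ∷ _)) (suc i) (suc j) i∈I j∈I x y eq =
  let i≡j , x≡y = position-injective I i j (drop-there i∈I) (drop-there j∈I) x y eq
  in cong suc i≡j , λ i≡last → x≡y (Finₚ.suc-injective i≡last)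

-- Of two distinct colours the smaller one is on the path, and everything of a larger colour hangs
-- below it. Only the leaves are pairwise incomparable, and they share one colour.
position-adjacent : (I : Subset (suc m)) (i j : Fin (suc m)) (i∈I : i ∈ I) (j∈I : j ∈ I)
  (x y : Fin n) → i ≢ j →
  Adj (closure (broom n I)) (position I i i∈I x) (position I j j∈I y)
position-adjacent (_       ∷ [])        zero zero _ _ x y i≢j = contradiction refl i≢j
position-adjacent (inside  ∷ (_ ∷ _))   zero zero _ _ x y i≢j = contradiction refl i≢j
position-adjacent (inside  ∷ (_ ∷ _))   zero (suc j) _ _ x y i≢j = fwd root
position-adjacent (inside  ∷ (_ ∷ _))   (suc i) zero _ _ x y i≢j = bwd root
position-adjacent (outside ∷ (_ ∷ _))   zero _ () _ x y i≢j
position-adjacent (outside ∷ (_ ∷ _))   (suc i) zero _ () x y i≢j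
position-adjacent (inside  ∷ I@(_ ∷ _)) (suc i) (suc j) i∈I j∈I x y i≢j =
  Sym.gmap below below
    (position-adjacent I i j (drop-there i∈I) (drop-there j∈I) x y (i≢j ∘ cong suc))
position-adjacent (outside ∷ I@(_ ∷ _)) (suc i) (suc j) i∈I j∈I x y i≢j =
  position-adjacent I i j (drop-there i∈I) (drop-there j∈I) x y (i≢j ∘ cong suc)

⊑-broom : (H : Graph W) (I : Subset (suc m)) (c : W → Fin (suc m)) →
  (∀ u → c u ∈ I) → (x : W → Fin n) →
  (∀ u v → c u ≡ c v → (c u ≡ fromℕ m → x u ≡ x v) → u ≡ v) →
  (∀ u v → Adj H u v → c u ≢ c v) → H ⊑ closure (broom n I)
⊑-broom H I c c∈I x separates proper =
    (λ u → position I (c u) (c∈I u) (x u))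
  , (λ {u} {v} eq →
       let cu≡cv , xu≡xv = position-injective I (c u) (c v) (c∈I u) (c∈I v) (x u) (x v) eq
       in separates u v cu≡cv xu≡xv)
  , (λ u v u~v →
       position-adjacent I (c u) (c v) (c∈I u) (c∈I v) (x u) (x v) (proper u v u~v))

-- Colourings obtained from embeddings into forests

Proper : Graph V → (V → Fin k) → Set
Proper G c = ∀ u v → Adj G u v → c u ≢ c v

rainbow-off-last⇒pcolouring : ∀ p (G : Graph (Fin n)) (c : Fin n → Fin (suc m)) →
  Proper G c → (∀ u v → c u ≡ c v → u ≡ v ⊎ c u ≡ fromℕ m) → IsPColouring p G c
rainbow-off-last⇒pcolouring {n} p G c proper rainbow I _ d (_ , least) =
  ≤-trans (least _ (broom n I , refl , embedding)) (height-broom n I)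
  where
  value-injective : ∀ {P : Fin n → Set} {u v : Refinement (Fin n) P} → value u ≡ value v → u ≡ v
  value-injective refl = refl

  embedding : induced G (λ u → c u ∈ I) ⊑ closure (broom n I)
  embedding = ⊑-broom (induced G (λ u → c u ∈ I)) I (c ∘ value)
    -- The membership proof in a `Refinement` is irrelevant; decidability of `_∈_` yields a relevant
    -- one.
    (λ { (u , [ u∈I ]) → recompute (c u ∈? I) u∈I }) value
    (λ u v cu≡cv last → value-injective
      ([ id , last ]′ (rainbow (value u) (value v) cu≡cv)))
    (λ u v → proper (value u) (value v))

inject₁-proper : (H : Graph W) (x : W → Fin n) → Injective _≡_ _≡_ x → Proper H (inject₁ ∘ x)
inject₁-proper H x x-inj u v u~v eq =
  Graph.~-irrefl H (x-inj (Finₚ.inject₁-injective eq)) u~v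

-- All vertices get different colours and the last colour stays free. This provides some colouring
-- from which a least one can be sought.
inject₁-pcolouring : ∀ p (G : Graph (Fin n)) → IsPColouring p G inject₁
inject₁-pcolouring p G = rainbow-off-last⇒pcolouring p G inject₁
  (inject₁-proper G id id) (λ _ _ eq → inj₁ (Finₚ.inject₁-injective eq))

-- A path with a vertex for each element of `Fin n` has a closure containing `H`, so some height is
-- attained and `¬¬-minimum` applies.
¬¬-treeDepth : (H : Graph W) (x : W → Fin n) → Injective _≡_ _≡_ x → ¬ ¬ (∃[ d ] IsTreeDepth H d)
¬¬-treeDepth {n = n} H x x-inj =
  ¬¬-minimum (λ h → ∃[ F ] height F ≡ h × H ⊑ closure F)
  (broom n (⊤ {suc n}) , refl , ⊑-broom H (⊤ {suc n}) (inject₁ ∘ x) (λ _ → ∈⊤) x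
    (λ _ _ eq _ → x-inj (Finₚ.inject₁-injective eq)) (inject₁-proper H x x-inj))

-- A single colour class is independent, so it embeds in a forest of isolated roots.
proper⇒1-colouring : (G : Graph (Fin n)) (c : Fin n → Fin k) → Proper G c → IsPColouring 1 G c
proper⇒1-colouring {n} G c proper I ∣I∣≤1 d (_ , least) with nonempty? I
... | yes (i , i∈I) = ≤-trans
  (least _ (replicate n (node []) , refl , leaf ∘ value , injective , adjacent))
  (≤-trans (height-leaves n) (x∈p⇒0<∣p∣ i∈I))
  where
  injective : Injective _≡_ _≡_ (leaf ∘ value {P = λ u → c u ∈ I})
  injective eq with refl ← leaf-injective eq = refl

  adjacent : ∀ u v → Adj (induced G (λ u → c u ∈ I)) u v → _
  adjacent (u , [ u∈I ]) (v , [ v∈I ]) u~v =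
    ⊥-elim-irr (proper u v u~v (∣p∣≤1⇒x≡y ∣I∣≤1 u∈I v∈I))
-- Here the bound is 0, so the forest must be empty.
... | no empty = ≤-trans (least 0 ([] , refl , absurd , (λ {u} → absurd u) , λ u → absurd u)) z≤n
  where
  absurd : ∀ {A : Set} → Refinement (Fin n) (λ u → c u ∈ I) → A
  absurd (u , [ u∈I ]) = ⊥-elim-irr (empty (c u , u∈I))

-- Tree-depth lower bound

depth : ∀ {F} → ForestVertex F → ℕ
depth root      = 0
depth (below x) = suc (depth x)
depth (later x) = depth x

depth<height : ∀ {F} (x : ForestVertex F) → depth x < height F
depth<height (root {cs} {ts})    = ≤-trans (s≤s z≤n) (m≤m⊔n (suc (height cs)) (height ts))
depth<height (below {cs} {ts} x) =
  ≤-trans (s≤s (depth<height x)) (m≤m⊔n (suc (height cs)) (height ts))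
depth<height (later {node cs} {ts} x) =
  ≤-trans (depth<height x) (m≤n⊔m (suc (height cs)) (height ts))

≺⇒depth< : ∀ {F} {x y : ForestVertex F} → x ≺ y → depth x < depth y
≺⇒depth< root        = s≤s z≤n
≺⇒depth< (below x≺y) = s≤s (≺⇒depth< x≺y)
≺⇒depth< (later x≺y) = ≺⇒depth< x≺y

-- All ancestors of `z` lie on the one path from a root to `z`.
ancestors-comparable : ∀ {F} {x y z : ForestVertex F} → x ≺ z → y ≺ z → x ≡ y ⊎ SymClosure _≺_ x y
ancestors-comparable root        root        = inj₁ refl
ancestors-comparable root        (below _)   = inj₂ (fwd root)
ancestors-comparable (below _)   root        = inj₂ (bwd root)
ancestors-comparable (below x≺z) (below y≺z) with ancestors-comparable x≺z y≺z
... | inj₁ refl = inj₁ refl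
... | inj₂ x~y  = inj₂ (Sym.gmap below below x~y)
ancestors-comparable (later x≺z) (later y≺z) with ancestors-comparable x≺z y≺z
... | inj₁ refl = inj₁ refl
... | inj₂ x~y  = inj₂ (Sym.gmap later later x~y)

module _ {F : Forest} (height≤2 : height F ≤ 2) where

  private
    no-chain : ∀ {x y z : ForestVertex F} → x ≺ y → y ≺ z → ⊥
    no-chain {z = z} x≺y y≺z = 1+n≰n (≤-trans (s≤s 2≤depth) (≤-trans (depth<height z) height≤2))
      where
      2≤depth : 2 ≤ depth z
      2≤depth = ≤-<-trans (≤-<-trans z≤n (≺⇒depth< x≺y)) (≺⇒depth< y≺z)

    parent-unique : ∀ {x y z : ForestVertex F} → x ≺ z → y ≺ z → x ≡ y
    parent-unique x≺z y≺z with ancestors-comparable x≺z y≺z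
    ... | inj₁ x≡y       = x≡y
    ... | inj₂ (fwd x≺y) = ⊥-elim (no-chain x≺y y≺z)
    ... | inj₂ (bwd y≺x) = ⊥-elim (no-chain y≺x x≺z)

  -- One of `x` and `y` is the parent of the other. The lower of the two has a further neighbour,
  -- `x′` or `y′`, which would be either a second parent or a vertex on a third level.
  closure-C₄-free : ∀ {x x′ y y′ : ForestVertex F} → x ≢ x′ → y ≢ y′ →
    Adj (closure F) x y → Adj (closure F) x y′ → Adj (closure F) x′ y → ⊥
  closure-C₄-free x≢x′ _ (fwd x≺y) _ (fwd x′≺y) = x≢x′ (parent-unique x≺y x′≺y)
  closure-C₄-free _ _    (fwd x≺y) _ (bwd y≺x′) = no-chain x≺y y≺x′
  closure-C₄-free _ _    (bwd y≺x) (fwd x≺y′) _ = no-chain y≺x x≺y′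
  closure-C₄-free _ y≢y′ (bwd y≺x) (bwd y′≺x) _ = y≢y′ (parent-unique y≺x y′≺x)

2-colouring-size : (G : Graph (Fin n)) (a b : Fin m → Fin n) →
  Injective _≡_ _≡_ a → Injective _≡_ _≡_ b → (∀ i j → Adj G (a i) (b j)) →
  (c : Fin n → Fin k) → IsPColouring 2 G c → m ≤ k
2-colouring-size {n} {m} {k} G a b a-inj b-inj a~b c colouring =
  -- The goal is decidable, so it may be refuted classically; tree-depth is available only under a
  -- double negation.
  decidable-stable (m ≤? k) λ m≰k →
    let i , i′ , i<i′ , ci≡ = Finₚ.pigeonhole (≰⇒> m≰k) (c ∘ a)
        j , j′ , j<j′ , cj≡ = Finₚ.pigeonhole (≰⇒> m≰k) (c ∘ b)
        p    = ⁅ c (a i) ⁆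
        q    = ⁅ c (b j) ⁆
        I    = p ∪ q
        U    = Refinement (Fin n) (λ u → c u ∈ I)
        -- `x l eq` is `a l` as a vertex of the subgraph induced by `I`, with `eq` placing its
        -- colour in `I`; `y` does the same for `b`.
        x    = λ l (eq : c (a i) ≡ c (a l)) →
                 U ∋ (a l , [ subst (_∈ I) eq (x∈p∪q⁺ {p = p} {q} (inj₁ (x∈⁅x⁆ (c (a i))))) ])
        y    = λ l (eq : c (b j) ≡ c (b l)) →
                 U ∋ (b l , [ subst (_∈ I) eq (x∈p∪q⁺ {p = p} {q} (inj₂ (x∈⁅x⁆ (c (b j))))) ])
        -- The two repeated colours may coincide, hence only an inequality.
        ∣I∣≤2 = subst (∣ I ∣ ≤_) (2≡ (c (a i)) (c (b j))) (∣p∪q∣≤∣p∣+∣q∣ p q)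
    in ¬¬-treeDepth (induced G (λ u → c u ∈ I)) value (λ { refl → refl }) λ
         { (d , td@((F , refl , f , f-inj , f-hom) , _)) →
           closure-C₄-free (≤-trans (colouring I ∣I∣≤2 d td) ∣I∣≤2)
             (λ eq → Finₚ.<⇒≢ i<i′ (a-inj (cong value (f-inj {x i refl} {x i′ ci≡} eq))))
             (λ eq → Finₚ.<⇒≢ j<j′ (b-inj (cong value (f-inj {y j refl} {y j′ cj≡} eq))))
             (f-hom (x i refl) (y j refl) (a~b i j))
             (f-hom (x i refl) (y j′ cj≡) (a~b i j′))
             (f-hom (x i′ ci≡) (y j refl) (a~b i′ j)) }
  where
  2≡ : (i j : Fin k) → ∣ ⁅ i ⁆ ∣ + ∣ ⁅ j ⁆ ∣ ≡ 2
  2≡ i j rewrite ∣⁅x⁆∣≡1 i | ∣⁅x⁆∣≡1 j = refl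

-- Complete bipartite graphs

Bool→Fin2 : Bool → Fin 2
Bool→Fin2 = Inverse.from Finₚ.2↔Bool

Bool→Fin2-injective : Injective _≡_ _≡_ Bool→Fin2
Bool→Fin2-injective = Injection.injective (↔⇒↣ (↔-sym Finₚ.2↔Bool))

module Bipartite (G : Graph (Fin n)) (side : Fin n → Bool)
                 (adjacency : ∀ u v → Adj G u v ⇔ side u ≢ side v) where

  adjacent : ∀ {u v} → side u ≢ side v → Adj G u v
  adjacent {u} {v} = Equivalence.from (adjacency u v)

  across : ∀ {u v} → Adj G u v → side u ≢ side v
  across {u} {v} = Equivalence.to (adjacency u v)

  clique≤2 : complete k ⊑ G → k ≤ 2
  clique≤2 {k} (f , _ , f-hom) = ≮⇒≥ λ 2<k →
    let i , j , i<j , eq = Finₚ.pigeonhole 2<k (Bool→Fin2 ∘ side ∘ f)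
    in across (f-hom i j (Finₚ.<⇒≢ i<j)) (Bool→Fin2-injective eq)

  side-1-colouring : IsPColouring 1 G (Bool→Fin2 ∘ side)
  side-1-colouring = proper⇒1-colouring G _ λ u v u~v eq → across u~v (Bool→Fin2-injective eq)

  part : Bool → List (Fin n)
  part b = filter (λ u → side u Boolₚ.≟ b) (allFin n)

  ∣part∣ : Bool → ℕ
  ∣part∣ b = length (part b)

  member : ∀ b → Fin (∣part∣ b) → Fin n
  member b = lookup (part b)

  member-injective : ∀ b → Injective _≡_ _≡_ (member b)
  member-injective b = lookup-injective (filter⁺ (λ u → side u Boolₚ.≟ b) (allFin⁺ n))

  side-member : ∀ b i → side (member b i) ≡ b
  side-member b i = proj₂ (∈-filter⁻ (λ u → side u Boolₚ.≟ b) {xs = allFin n} (∈-lookup i))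

  rank : ∀ {b} u → side u ≡ b → Fin (∣part∣ b)
  rank {b} u s = index (∈-filter⁺ (λ u → side u Boolₚ.≟ b) (∈-allFin u) s)

  rank-injective : ∀ {b} u v s t → rank {b} u s ≡ rank v t → u ≡ v
  rank-injective {b} u v s t eq = trans
    (lookup-index (∈-filter⁺ (λ u → side u Boolₚ.≟ b) (∈-allFin u) s))
    (trans (cong (member b) eq)
      (sym (lookup-index (∈-filter⁺ (λ u → side u Boolₚ.≟ b) (∈-allFin v) t))))

  -- The colour shared by the other part is the last one, the colour that `broom` gives its leaves.
  rankColour : ∀ b → Fin n → Fin (suc (∣part∣ b))
  rankColour b u with side u Boolₚ.≟ b
  ... | yes s = inject₁ (rank u s)
  ... | no  _ = fromℕ _

  rankColour-proper : ∀ b → Proper G (rankColour b)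
  rankColour-proper b u v u~v eq with side u Boolₚ.≟ b | side v Boolₚ.≟ b
  ... | yes s | yes t = across u~v (trans s (sym t))
  ... | yes _ | no  _ = Finₚ.fromℕ≢inject₁ (sym eq)
  ... | no  _ | yes _ = Finₚ.fromℕ≢inject₁ eq
  -- Two sides different from `b` both equal its negation.
  ... | no ¬s | no ¬t = across u~v (trans (Boolₚ.¬-not ¬s) (sym (Boolₚ.¬-not ¬t)))

  rankColour-pcolouring : ∀ p b → IsPColouring p G (rankColour b)
  rankColour-pcolouring p b = rainbow-off-last⇒pcolouring p G (rankColour b)
    (rankColour-proper b) rainbow
    where
    rainbow : ∀ u v → rankColour b u ≡ rankColour b v →
              u ≡ v ⊎ rankColour b u ≡ fromℕ (∣part∣ b)
    rainbow u v eq with side u Boolₚ.≟ b | side v Boolₚ.≟ b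
    ... | no  _ | _     = inj₂ refl
    ... | yes s | yes t = inj₁ (rank-injective u v s t (Finₚ.inject₁-injective eq))
    ... | yes _ | no  _ = contradiction (sym eq) Finₚ.fromℕ≢inject₁

  -- The `k * k` vertices of each part are indexed by pairs: branch vertex `u` goes to the diagonal
  -- pair in one part, the subdividing vertex of the edge from `u` to `v` to the pair of `u` and `v`
  -- in the other.
  complete∈TM : ∀ {r} → 1 ≤ r → (∀ b → k * k ≤ ∣part∣ b) → TM r G (complete k)
  complete∈TM {k} 1≤r large = (λ _ _ → 1) , (λ _ _ → 1≤r) , f , f-injective
                            , λ { _ _ (fwd s) → hom s ; _ _ (bwd s) → Graph.~-sym G (hom s) }
    where
    vertex : Bool → Fin k → Fin k → Fin n
    vertex b i j = member b (inject≤ (combine i j) (large b))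

    vertex-injective : ∀ b {i j i′ j′} → vertex b i j ≡ vertex b i′ j′ → i ≡ i′ × j ≡ j′
    vertex-injective b eq = Finₚ.combine-injective _ _ _ _
      (Finₚ.inject≤-injective (large b) (large b) _ _ (member-injective b eq))

    side-vertex : ∀ b i j → side (vertex b i j) ≡ b
    side-vertex b i j = side-member b _

    vertex-sides : ∀ {b b′ i j i′ j′} → b ≢ b′ → side (vertex b i j) ≢ side (vertex b′ i′ j′)
    vertex-sides {b} {b′} {i} {j} {i′} {j′} b≢b′ eq =
      b≢b′ (trans (sym (side-vertex b i j)) (trans eq (side-vertex b′ i′ j′)))

    f : SubdivisionVertex (complete k) (λ _ _ → 1) → Fin n
    f (branch u)        = vertex false u u
    f (inner u v _ _ _) = vertex true u v

    f-injective : Injective _≡_ _≡_ f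
    f-injective {branch u} {branch v} eq = cong branch (proj₁ (vertex-injective false eq))
    f-injective {branch _} {inner _ _ _ _ _} eq =
      contradiction (cong side eq) (vertex-sides λ ())
    f-injective {inner _ _ _ _ _} {branch _} eq =
      contradiction (cong side eq) (vertex-sides λ ())
    f-injective {inner _ _ _ _ zero} {inner _ _ _ _ zero} eq
      with refl , refl ← vertex-injective true eq = refl

    hom : ∀ {x y} → PathStep (complete k) (λ _ _ → 1) x y → Adj G (f x) (f y)
    -- Each edge has exactly one inner vertex, so the steps `whole` and `next` cannot occur.
    hom (whole _ _ ())
    hom (first _)                      = adjacent (vertex-sides λ ())
    hom (next {i = zero} {j = zero} ())
    hom (last _)                       = adjacent (vertex-sides λ ())

complete-cliqueNumber : ∀ k → IsCliqueNumber (complete k) k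
complete-cliqueNumber k = (id , id , λ _ _ → id) , λ _ (_ , f-inj , _) → Finₚ.injective⇒≤ f-inj

-- Heredity and weak boundedness

𝓑-hereditary : Hereditary 𝓑
𝓑-hereditary H G (f , _ , f-iso) (side , adjacency) =
  side ∘ f , λ x y → adjacency (f x) (f y) ⇔-∘ f-iso x y

𝓑-weaklyChiBounded : ∀ p → 1 ≤ p → WeaklyChiBounded p 𝓑
-- For `p` equal to 1 no subdivision is allowed and `complete∈TM` does not apply; the two sides
-- serve as colours.
𝓑-weaklyChiBounded (suc zero)      _ = const 2 , λ { G (side , adjacency) w k _ (_ , least) →
  least 2 (_ , Bipartite.side-1-colouring G side adjacency) }
𝓑-weaklyChiBounded p@(suc (suc r)) _ = (λ w → suc w * suc w) , bound
  where
  bound : ∀ {n} (G : Graph (Fin n)) → 𝓑 G → ∀ w k →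
          IsClassCliqueNumber (TM (suc r) G) w → IsChi p G k → k ≤ suc w * suc w
  -- By `rankColour`, `k` is at most one more than the size of either part. If `k` exceeds the
  -- square of `suc w`, both parts have at least that many vertices, and a clique on `suc w`
  -- vertices enters the class.
  bound G (side , adjacency) w k (upper , _) (_ , least) = ≮⇒≥ λ large →
    1+n≰n (upper (suc w) (suc w , complete (suc w) ,
      complete∈TM (s≤s z≤n) (λ b → ≤-pred (≤-trans large (least _ (_ , rankColour-pcolouring p b))))
      , complete-cliqueNumber (suc w)))
    where
    open Bipartite G side adjacency

-- Failure of strong boundedness

leftSide : Fin m ⊎ Fin m → Bool
leftSide = [ const true , const false ]′

completeBipartite : ∀ m → Graph (Fin (m + m))
completeBipartite m = record
  { _~_      = λ u v → leftSide (splitAt m u) ≢ leftSide (splitAt m v)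
  ; ~-sym    = λ u≢v v≡u → u≢v (sym v≡u)
  ; ~-irrefl = λ { refl u≢u → u≢u refl }
  }

𝓑-not-strongly-χ₂-bounded : ¬ StronglyChiBounded 2 𝓑
𝓑-not-strongly-χ₂-bounded (f , bound) =
  ¬¬-minimum (λ k → Σ[ c ∈ (Fin (N + N) → Fin k) ] IsPColouring 2 G c)
             (inject₁ , inject₁-pcolouring 2 G) λ
  -- The contradiction is `N ≤ k ≤ f 2`.
  { (k , χ@((c , colouring) , _)) → 1+n≰n (≤-trans
      (2-colouring-size G (_↑ˡ N) (N ↑ʳ_) (Finₚ.↑ˡ-injective N _ _) (Finₚ.↑ʳ-injective N _ _)
        left~right c colouring)
      (bound G bipartite 2 k ω χ)) }
  where
  -- One more than the bound at clique number 2. Being positive, it also gives the edge needed for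
  -- the clique number to be 2.
  N = suc (f 2)
  G = completeBipartite N

  bipartite : 𝓑 G
  bipartite = leftSide ∘ splitAt N , λ _ _ → mk⇔ id id

  left~right : ∀ i j → Adj G (i ↑ˡ N) (N ↑ʳ j)
  left~right i j rewrite Finₚ.splitAt-↑ˡ N i N | Finₚ.splitAt-↑ʳ N N j = λ ()

  ω : IsCliqueNumber G 2
  ω = (edge , edge-injective , edge-hom)
    , λ _ → Bipartite.clique≤2 G (leftSide ∘ splitAt N) (λ _ _ → mk⇔ id id)
    where
    edge : Fin 2 → Fin (N + N)
    edge zero       = zero ↑ˡ N
    edge (suc zero) = N ↑ʳ zero

    edge-hom : ∀ x y → x ≢ y → Adj G (edge x) (edge y)
    edge-hom zero       zero       x≢y = contradiction refl x≢y
    edge-hom zero       (suc zero) _   = left~right zero zero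
    edge-hom (suc zero) zero       _   =
      Graph.~-sym G {edge zero} {edge (suc zero)} (left~right zero zero)
    edge-hom (suc zero) (suc zero) x≢y = contradiction refl x≢y

    edge-injective : Injective _≡_ _≡_ edge
    -- Distinct arguments have adjacent images, and no vertex is adjacent to itself.
    edge-injective {x} {y} eq = decidable-stable (x Finₚ.≟ y) λ x≢y →
      Graph.~-irrefl G eq (edge-hom x y x≢y)

proposition2 : Hereditary 𝓑
    × (∀ (p : ℕ) → 1 ≤ p → WeaklyChiBounded p 𝓑)
    × (∃[ p ] (1 ≤ p × ¬ StronglyChiBounded p 𝓑))
proposition2 = 𝓑-hereditary , 𝓑-weaklyChiBounded , 2 , s≤s z≤n , 𝓑-not-strongly-χ₂-bounded
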